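{- The projectively universal homogeneous profinite graph $\mathbb P$ has a dense $G_\delta$ set of isolated vertices; that is, the set of isolated vertices of $\mathbb P$ is a dense $G_\delta$ subset of the topological space of vertices of $\mathbb P$.
   Context: A graph is a pair $G=(V,E)$ where $E$ is a symmetric and reflexive binary relation on $V$ (every vertex has a loop). A vertex is isolated if it is adjacent to itself only (this is not topological isolation). A homomorphism is an edge-preserving map. A homomorphism $f\colon X\to Y$ is strict if for all adjacent $p,q$ in the range of $f$ there are adjacent $a,b\in X$ with $f(a)=p$, $f(b)=q$; a surjective strict homomorphism is called a quotient map. A profinite graph is a nonempty topological graph that is (simultaneously graph-isomorphic and homeomorphic to) the inverse limit of a sequence of finite (discrete) graphs with quotient maps as bonding maps, where $(x_n)$ and $(y_n)$ are adjacent in the limit iff $x_n,y_n$ are adjacent for every $n$. $\mathbb P$ denotes the unique (up to topological graph isomorphism) second countable profinite graph satisfying: given continuous quotient maps $f\colon\mathbb P\to S$ and $q\colon T\to S$, where $S,T$ are nonempty finite (discrete) graphs, there exists a continuous quotient map $g\colon\mathbb P\to T$ such that $q\circ g=f$. (Its existence and uniqueness are given by Fraïssé theory: it is the projective Fraïssé limit of nonempty finite graphs with quotient maps.) -}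

module Defs where

open import Level using (0ℓ)
open import Data.Nat.Base using (ℕ; suc; _≤_; _⊔_)
open import Data.Nat.Properties using (≤-trans; m≤m⊔n; m≤n⊔m)
open import Data.Fin.Base using (Fin)
open import Data.Product.Base using (Σ-syntax; ∃-syntax; ∃₂; _×_; _,_; proj₁; proj₂)
open import Function.Base using (_∘_)
open import Function.Bundles using (Func; Inverse)
open import Function.Definitions using (StrictlySurjective)
open import Relation.Binary.Bundles using (Setoid)
open import Relation.Binary.Core using (Rel; _Preserves_⟶_)
open import Relation.Binary.Definitions using (Reflexive; Symmetric; _Respects₂_; _Respects_)
open import Relation.Binary.PropositionalEquality.Properties as ≡ using ()
open import Relation.Unary using (Pred; _∈_; _⊆_; _≐_; _≬_; _∩_; _⊢_; U; ⋃; ⋂; Satisfiable)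

record Graph : Set₁ where
  field
    vertices : Setoid 0ℓ 0ℓ
  open Setoid vertices public using (_≈_) renaming (Carrier to Vertex)
  field
    Adj      : Rel Vertex 0ℓ
    Adj-resp : Adj Respects₂ _≈_
    Adj-refl : Reflexive Adj
    Adj-sym  : Symmetric Adj

  Isolated : Pred Vertex 0ℓ
  Isolated x = ∀ y → Adj x y → y ≈ x

  Finite : Set
  Finite = ∃[ n ] Inverse (≡.setoid (Fin n)) vertices

module _ (X Y : Graph) where
  private
    module X = Graph X
    module Y = Graph Y

  VertexMap : Set
  VertexMap = Func X.vertices Y.vertices

  module _ (f : VertexMap) where
    open Func f using (to)

    IsHomomorphism : Set
    IsHomomorphism = to Preserves X.Adj ⟶ Y.Adj

    InRange : Pred Y.Vertex 0ℓ
    InRange p = ∃[ a ] to a Y.≈ p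

    IsStrict : Set
    IsStrict = ∀ p q → p ∈ InRange → q ∈ InRange → Y.Adj p q →
               ∃₂ λ a b → X.Adj a b × to a Y.≈ p × to b Y.≈ q

    record IsQuotientMap : Set where
      field
        homomorphism : IsHomomorphism
        strict       : IsStrict
        surjective   : StrictlySurjective Y._≈_ to

-- Subsets are predicates in Set₀ and unions are indexed by types in Set₀.
record Topology (S : Setoid 0ℓ 0ℓ) : Set₁ where
  open Setoid S using (_≈_) renaming (Carrier to Point)
  field
    IsOpen        : Pred Point 0ℓ → Set
    IsOpen-resp-≐ : ∀ {A B} → A ≐ B → IsOpen A → IsOpen B
    open-resp-≈   : ∀ {A} → IsOpen A → A Respects _≈_
    whole-open    : IsOpen U
    ∩-open        : ∀ {A B} → IsOpen A → IsOpen B → IsOpen (A ∩ B)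
    ⋃-open        : ∀ {I : Set} {A : I → Pred Point 0ℓ} →
                    (∀ i → IsOpen (A i)) → IsOpen (⋃ I A)

  Dense : Pred Point 0ℓ → Set₁
  Dense D = ∀ A → IsOpen A → Satisfiable A → A ≬ D

  Gδ : Pred Point 0ℓ → Set₁
  Gδ D = Σ[ A ∈ (ℕ → Pred Point 0ℓ) ] (∀ n → IsOpen (A n)) × D ≐ ⋂ ℕ A

  SecondCountable : Set₁
  SecondCountable = Σ[ B ∈ (ℕ → Pred Point 0ℓ) ]
    (∀ n → IsOpen (B n)) ×
    (∀ A → IsOpen A → ∀ x → x ∈ A → ∃[ n ] x ∈ B n × B n ⊆ A)

discreteTopology : (S : Setoid 0ℓ 0ℓ) → Topology S
discreteTopology S = record
  { IsOpen        = λ A → A Respects _≈_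
  ; IsOpen-resp-≐ = λ A≐B resp x≈y → proj₁ A≐B ∘ resp x≈y ∘ proj₂ A≐B
  ; open-resp-≈   = λ resp → resp
  ; whole-open    = λ _ _ → _
  ; ∩-open        = λ rA rB x≈y (a , b) → rA x≈y a , rB x≈y b
  ; ⋃-open        = λ rA x≈y (i , a) → i , rA i x≈y a
  }
  where open Setoid S using (_≈_)

record TopologicalGraph : Set₁ where
  field
    graph    : Graph
    topology : Topology (Graph.vertices graph)
  open Graph graph public
  open Topology topology public

discrete : Graph → TopologicalGraph
discrete G = record { graph = G ; topology = discreteTopology (Graph.vertices G) }

module _ (X Y : TopologicalGraph) where
  private
    module X = TopologicalGraph X
    module Y = TopologicalGraph Y

  IsContinuous : VertexMap X.graph Y.graph → Set₁
  IsContinuous f = ∀ A → Y.IsOpen A → X.IsOpen (Func.to f ⊢ A)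

  record IsContinuousQuotientMap (f : VertexMap X.graph Y.graph) : Set₁ where
    field
      continuous : IsContinuous f
      quotient   : IsQuotientMap X.graph Y.graph f

record TopologicalGraphIso (X Y : TopologicalGraph) : Set₁ where
  private
    module X = TopologicalGraph X
    module Y = TopologicalGraph Y
  field
    inverse : Inverse X.vertices Y.vertices
  to : VertexMap X.graph Y.graph
  to = record { to = Inverse.to inverse ; cong = Inverse.to-cong inverse }
  from : VertexMap Y.graph X.graph
  from = record { to = Inverse.from inverse ; cong = Inverse.from-cong inverse }
  field
    to-homomorphism   : IsHomomorphism X.graph Y.graph to
    from-homomorphism : IsHomomorphism Y.graph X.graph from
    to-continuous     : IsContinuous X Y to
    from-continuous   : IsContinuous Y X from

record InverseSequence : Set₁ where
  field
    obj           : ℕ → Graph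
    obj-finite    : ∀ n → Graph.Finite (obj n)
    bond          : ∀ n → VertexMap (obj (suc n)) (obj n)
    bond-quotient : ∀ n → IsQuotientMap (obj (suc n)) (obj n) (bond n)

module _ (L : InverseSequence) where
  open InverseSequence L
  private
    module G n = Graph (obj n)
    module V n = Setoid (G.vertices n)

  Thread : Set
  Thread = Σ[ x ∈ (∀ n → G.Vertex n) ] (∀ n → G._≈_ n (Func.to (bond n) (x (suc n))) (x n))

  limitGraph : Graph
  limitGraph = record
    { vertices = record
        { Carrier       = Thread
        ; _≈_           = λ x y → ∀ n → G._≈_ n (proj₁ x n) (proj₁ y n)
        ; isEquivalence = record
            { refl  = λ n → V.refl n
            ; sym   = λ p n → V.sym n (p n)
            ; trans = λ p q n → V.trans n (p n) (q n)
            }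
        }
    ; Adj      = λ x y → ∀ n → G.Adj n (proj₁ x n) (proj₁ y n)
    ; Adj-resp = (λ p a n → proj₁ (G.Adj-resp n) (p n) (a n))
               , (λ p a n → proj₂ (G.Adj-resp n) (p n) (a n))
    ; Adj-refl = λ n → G.Adj-refl n
    ; Adj-sym  = λ a n → G.Adj-sym n (a n)
    }

  -- The basic neighbourhoods of x in the product of the discrete spaces obj n
  -- are the sets of points agreeing with x in coordinates 0, …, n.
  AgreeUpTo : ℕ → Rel Thread 0ℓ
  AgreeUpTo n x y = ∀ i → i ≤ n → G._≈_ i (proj₁ x i) (proj₁ y i)

  limit : TopologicalGraph
  limit = record
    { graph    = limitGraph
    ; topology = record
        { IsOpen        = λ A → ∀ x → x ∈ A → ∃[ n ] (∀ y → AgreeUpTo n x y → y ∈ A)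
        ; IsOpen-resp-≐ = λ (A⊆B , B⊆A) oA x x∈B →
            let n , h = oA x (B⊆A x∈B) in n , λ y p → A⊆B (h y p)
        ; open-resp-≈   = λ oA {x} {y} x≈y x∈A → proj₂ (oA x x∈A) y (λ i _ → x≈y i)
        ; whole-open    = λ _ _ → 0 , λ _ _ → _
        ; ∩-open        = λ oA oB x (a , b) →
            let m , h = oA x a
                n , k = oB x b
            in m ⊔ n , λ y p → h y (λ i i≤m → p i (≤-trans i≤m (m≤m⊔n m n)))
                             , k y (λ i i≤n → p i (≤-trans i≤n (m≤n⊔m m n)))
        ; ⋃-open        = λ oA x (i , a) →
            let n , h = oA i x a in n , λ y p → i , h y p
        }
    }

record IsProfinite (X : TopologicalGraph) : Set₁ where
  field
    nonempty : TopologicalGraph.Vertex X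
    sequence : InverseSequence
    iso      : TopologicalGraphIso X (limit sequence)

HasExtensionProperty : TopologicalGraph → Set₁
HasExtensionProperty P =
  (S T : Graph) → Graph.Finite S → Graph.Finite T → Graph.Vertex S → Graph.Vertex T →
  (f : VertexMap P.graph S) → IsContinuousQuotientMap P (discrete S) f →
  (q : VertexMap T S) → IsQuotientMap T S q →
  Σ[ g ∈ VertexMap P.graph T ]
    IsContinuousQuotientMap P (discrete T) g ×
    (∀ x → Graph._≈_ S (Func.to q (Func.to g x)) (Func.to f x))
  where module P = TopologicalGraph P

-- The defining properties of ℙ, which determine it up to topological graph
-- isomorphism.
record IsUniversalHomogeneous (P : TopologicalGraph) : Set₁ where
  field
    profinite       : IsProfinite P
    secondCountable : TopologicalGraph.SecondCountable P
    extension       : HasExtensionProperty P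

{-# OPTIONS --safe #-}

-- Isolated vertices form a Gδ: x is isolated iff for every n all its neighbours
-- agree with x at coordinate n, and by compactness each of these conditions is
-- open. They are dense: given a vertex v of the n-th finite graph S, add a disjoint
-- isolated vertex to S and map it to v. Lifting ℙ → S through this quotient map
-- yields a nonempty clopen set inside the fibre of v with no edges leaving it.
-- Iterating, a decreasing sequence of such sets shrinks to a single point, all of
-- whose neighbours lie in every set of the sequence.
module Submission where

open import Defs
open import Level using (0ℓ)
open import Data.Empty using (⊥-elim)
open import Data.Fin.Base as Fin using (Fin)
open import Data.Maybe.Base using (Maybe; just; nothing; fromMaybe)
open import Data.Maybe.Relation.Binary.Pointwise as Pointwise using (Pointwise; just; nothing)
open import Data.Nat.Base using (ℕ; zero; suc; _≤_; _<_; _⊔_; z≤n; s≤s)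
open import Data.Nat.Properties
  using (≤-refl; ≤-trans; ≤-total; ≤-<-trans; m≤m⊔n; m≤n⊔m; n≤1+n; m≤n⇒m<n∨m≡n)
open import Data.Product.Base using (Σ-syntax; ∃-syntax; ∃₂; _×_; _,_; proj₁; proj₂; map₂)
open import Data.Sum.Base using (_⊎_; inj₁; inj₂)
open import Function.Base using (_∘_)
open import Function.Bundles using (Func; Inverse)
open import Relation.Binary.Bundles using (Setoid)
open import Relation.Binary.PropositionalEquality.Core using (refl; cong)
open import Relation.Nullary using (¬_; yes; no)
open import Relation.Nullary.Decidable using (decidable-stable)
open import Relation.Unary using (Pred; U; _∩_; _∪_)
open import Axiom.ExcludedMiddle using (ExcludedMiddle)

-- Infinite pigeonhole principle for finite vertex sets.

Frequently : Pred ℕ 0ℓ → Set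
Frequently P = ∀ M → ∃[ m ] M ≤ m × P m

frequently-map : ∀ {P Q : Pred ℕ 0ℓ} → (∀ {m} → P m → Q m) → Frequently P → Frequently Q
frequently-map P⊆Q freq M = map₂ (map₂ P⊆Q) (freq M)

module _ (em : ExcludedMiddle 0ℓ) where

  -- Either `P` fails from some `M₀` on, and then every witness beyond `M ⊔ M₀` must come from `Q`,
  -- or no such `M₀` exists, which classically makes `P` frequent.
  frequently-∪ : ∀ {P Q : Pred ℕ 0ℓ} → Frequently (P ∪ Q) → Frequently P ⊎ Frequently Q
  frequently-∪ {P} {Q} freq with em {∃[ M ] (∀ m → M ≤ m → ¬ P m)}
  ... | no ¬eventually¬P = inj₁ λ M → decidable-stable em λ ¬p →
          ¬eventually¬P (M , λ m M≤m Pm → ¬p (m , M≤m , Pm))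
  ... | yes (M₀ , ¬P) = inj₂ λ M → freqQ M (freq (M ⊔ M₀))
    where
    freqQ : ∀ M → ∃[ m ] M ⊔ M₀ ≤ m × (P ∪ Q) m → ∃[ m ] M ≤ m × Q m
    freqQ M (m , M≤m , inj₁ Pm) = ⊥-elim (¬P m (≤-trans (m≤n⊔m M M₀) M≤m) Pm)
    freqQ M (m , M≤m , inj₂ Qm) = m , ≤-trans (m≤m⊔n M M₀) M≤m , Qm

  frequently-Fin : ∀ {n} {P : Fin n → Pred ℕ 0ℓ} →
                   Frequently (λ m → ∃[ i ] P i m) → ∃[ i ] Frequently (P i)
  frequently-Fin {zero} freq with freq 0
  ... | _ , _ , () , _
  frequently-Fin {suc n} {P} freq
    with frequently-∪ (frequently-map {Q = P Fin.zero ∪ (λ m → ∃[ i ] P (Fin.suc i) m)}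
           (λ { (Fin.zero , p) → inj₁ p ; (Fin.suc i , p) → inj₂ (i , p) }) freq)
  ... | inj₁ freq₀ = Fin.zero , freq₀
  ... | inj₂ freqₛ with frequently-Fin freqₛ
  ...   | i , freqᵢ = Fin.suc i , freqᵢ

  module _ (G : Graph) (finite : Graph.Finite G) where
    open Graph G using (Vertex; _≈_)
    private
      module V = Setoid (Graph.vertices G)
      module F = Inverse (proj₂ finite)

    -- Keeping `P` in the conclusion allows iteration: each new coordinate is fixed along the
    -- indices already selected.
    frequently-value : ∀ {P : Pred ℕ 0ℓ} (y : ℕ → Vertex) → Frequently P →
                       ∃[ v ] Frequently (P ∩ (λ m → y m ≈ v))
    frequently-value {P} y freq = F.to (proj₁ p) , proj₂ p
      where
      p = frequently-Fin {P = λ i → P ∩ (λ m → y m ≈ F.to i)} (frequently-map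
            (λ {m} Pm → F.from (y m) , Pm , V.sym (F.strictlyInverseˡ (y m))) freq)

-- Lifting edges to threads.

tail : InverseSequence → InverseSequence
tail L = record
  { obj           = λ n → obj (suc n)
  ; obj-finite    = λ n → obj-finite (suc n)
  ; bond          = λ n → bond (suc n)
  ; bond-quotient = λ n → bond-quotient (suc n)
  }
  where open InverseSequence L

tail-thread : ∀ L → Thread (tail L) → Thread L
tail-thread L (x , c) =
  (λ { zero → Func.to (bond 0) (x 0) ; (suc n) → x n }) ,
  (λ { zero → Setoid.refl (Graph.vertices (obj 0)) ; (suc n) → c n })
  where open InverseSequence L

-- Strictness of the bonds lifts an edge one level up. Iterating builds both threads at once, so
-- they stay adjacent at every level.
lift-edge₀ : ∀ L → let open InverseSequence L ; open Graph (obj 0) in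
             ∀ {a b} → Adj a b →
             ∃₂ λ (x y : Thread L) → Graph.Adj (limitGraph L) x y × proj₁ x 0 ≈ a × proj₁ y 0 ≈ b
lift-edge₀ L {a} {b} a~b =
  (proj₁ ∘ edge , λ n → proj₁ (proj₂ (next n (edge n)))) ,
  (proj₁ ∘ proj₂ ∘ edge , λ n → proj₂ (proj₂ (next n (edge n)))) ,
  (λ n → proj₂ (proj₂ (edge n))) , V.refl 0 , V.refl 0
  where
  open InverseSequence L
  module G n = Graph (obj n)
  module V n = Setoid (G.vertices n)

  Edge : ℕ → Set
  Edge n = ∃₂ λ (a b : G.Vertex n) → G.Adj n a b

  next : ∀ n (e : Edge n) → Σ[ e′ ∈ Edge (suc n) ]
         (G._≈_ n (Func.to (bond n) (proj₁ e′)) (proj₁ e) ×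
          G._≈_ n (Func.to (bond n) (proj₁ (proj₂ e′))) (proj₁ (proj₂ e)))
  next n (a , b , a~b) =
    let open IsQuotientMap (bond-quotient n)
        a′ , b′ , a′~b′ , a′↦a , b′↦b = strict a b (surjective a) (surjective b) a~b
    in (a′ , b′ , a′~b′) , a′↦a , b′↦b

  edge : ∀ n → Edge n
  edge zero    = a , b , a~b
  edge (suc n) = proj₁ (next n (edge n))

-- Induction by dropping the first graph; coordinate 0 is then recovered through `bond 0`, which
-- preserves adjacency.
lift-edge : ∀ L n → let open InverseSequence L ; open Graph (obj n) in
            ∀ {a b} → Adj a b →
            ∃₂ λ (x y : Thread L) → Graph.Adj (limitGraph L) x y × proj₁ x n ≈ a × proj₁ y n ≈ b
lift-edge L zero a~b = lift-edge₀ L a~b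
lift-edge L (suc n) a~b =
  let x , y , x~y , x↦a , y↦b = lift-edge (tail L) n a~b
  in tail-thread L x , tail-thread L y ,
     (λ { zero → IsQuotientMap.homomorphism (bond-quotient 0) (x~y 0) ; (suc k) → x~y k }) ,
     x↦a , y↦b
  where open InverseSequence L

-- Coordinates of the limit and successive refinement.

module _ (L : InverseSequence) where
  open InverseSequence L
  private
    module G n = Graph (obj n)
    module V n = Setoid (G.vertices n)
    module Lim = TopologicalGraph (limit L)

  projection : ∀ n → VertexMap (limitGraph L) (obj n)
  projection n = record { to = λ x → proj₁ x n ; cong = λ x≈y → x≈y n }

  projection-surjective : ∀ n v → Σ[ x ∈ Thread L ] G._≈_ n (proj₁ x n) v
  projection-surjective n v =
    -- The edge lifted here is the loop at `v`.
    let x , _ , _ , x↦v , _ = lift-edge L n (G.Adj-refl n {v}) in x , x↦v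

  -- The bonds determine every lower coordinate from coordinate `n`.
  agreeUpTo : ∀ (x y : Thread L) n → G._≈_ n (proj₁ x n) (proj₁ y n) → AgreeUpTo L n x y
  agreeUpTo x y n xₙ≈yₙ i i≤n with m≤n⇒m<n∨m≡n i≤n
  ... | inj₂ refl = xₙ≈yₙ
  agreeUpTo x y (suc n) xₙ≈yₙ i i≤n | inj₁ (s≤s i≤n′) = agreeUpTo x y n
    (V.trans n (V.sym n (proj₂ x n)) (V.trans n (Func.cong (bond n) xₙ≈yₙ) (proj₂ y n))) i i≤n′

  projection-continuous : ∀ n → IsContinuous (limit L) (discrete (obj n)) (projection n)
  projection-continuous n A resp x x∈A = n , λ y x≈y → resp (x≈y n ≤-refl) x∈A

  NeighboursAgreeAt : ℕ → Pred (Thread L) 0ℓ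
  NeighboursAgreeAt n x = ∀ y → Lim.Adj x y → G._≈_ n (proj₁ y n) (proj₁ x n)

  -- One shrinking step: the ball of depth `m` around `x′` lies in the ball of depth `n` around `x`,
  -- and so do all neighbours of its points. Requiring `n < m` forces the depths to infinity.
  Refinement : ℕ → Thread L → ℕ → Thread L → Set
  Refinement n x m x′ = n < m × AgreeUpTo L n x x′ ×
    (∀ z y → AgreeUpTo L m x′ z → Lim.Adj z y → AgreeUpTo L n x y)

  module _ (refine : ∀ n x → ∃₂ (Refinement n x)) (n₀ : ℕ) (x₀ : Thread L) where

    private
      stage : ℕ → ℕ × Thread L
      stage zero    = n₀ , x₀
      stage (suc k) = let m , x′ , _ = refine (proj₁ (stage k)) (proj₂ (stage k)) in m , x′

      depth : ℕ → ℕ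
      depth k = proj₁ (stage k)

      point : ℕ → Thread L
      point k = proj₂ (stage k)

      stage-refines : ∀ k → Refinement (depth k) (point k) (depth (suc k)) (point (suc k))
      stage-refines k = proj₂ (proj₂ (refine (depth k) (point k)))

      k≤depth : ∀ k → k ≤ depth k
      k≤depth zero    = z≤n
      k≤depth (suc k) = ≤-<-trans (k≤depth k) (proj₁ (stage-refines k))

      depth-mono : ∀ {j k} → j ≤ k → depth j ≤ depth k
      depth-mono {j} {k} j≤k with m≤n⇒m<n∨m≡n j≤k
      ... | inj₂ refl = ≤-refl
      depth-mono {j} {suc k} j≤k | inj₁ (s≤s j≤k′) =
        ≤-trans (depth-mono j≤k′) (≤-trans (n≤1+n _) (proj₁ (stage-refines k)))

      points-agree : ∀ {j k} → j ≤ k → AgreeUpTo L (depth j) (point j) (point k)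
      points-agree {j} {k} j≤k i i≤d with m≤n⇒m<n∨m≡n j≤k
      ... | inj₂ refl = V.refl i
      points-agree {j} {suc k} j≤k i i≤d | inj₁ (s≤s j≤k′) = V.trans i
        (points-agree j≤k′ i i≤d)
        (proj₁ (proj₂ (stage-refines k)) i (≤-trans i≤d (depth-mono j≤k′)))

      -- Coordinate `i` can be read off at stage `i`: since `i ≤ depth i`, later stages no longer
      -- change it.
      diagonal : Thread L
      diagonal = (λ i → proj₁ (point i) i) , λ i → V.trans i (proj₂ (point (suc i)) i)
        (V.sym i (points-agree (n≤1+n i) i (k≤depth i)))

      diagonal-agrees : ∀ k → AgreeUpTo L (depth k) (point k) diagonal
      diagonal-agrees k i i≤d with ≤-total k i
      ... | inj₁ k≤i = points-agree k≤i i i≤d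
      ... | inj₂ i≤k = V.sym i (points-agree i≤k i (k≤depth i))

    -- The diagonal lies in the ball of stage `k + 1`, so its neighbours lie in that of stage `k`.
    -- They therefore share coordinate `k` with `point k`, which is by definition coordinate `k` of
    -- the diagonal.
    refinable⇒isolated : ∃[ z ] AgreeUpTo L n₀ x₀ z × Lim.Isolated z
    refinable⇒isolated = diagonal , diagonal-agrees 0 , λ y z~y k → V.sym k
      (proj₂ (proj₂ (stage-refines k)) diagonal y (diagonal-agrees (suc k)) z~y k (k≤depth k))

  -- Compactness and the open conditions.

  module _ (em : ExcludedMiddle 0ℓ) where

    -- Sequential compactness, in the style of König's lemma: a value taken infinitely often at
    -- coordinate `k` is extended to one at coordinate `k + 1`.
    cluster-thread : ∀ (y : ℕ → Thread L) → Σ[ c ∈ Thread L ]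
                     (∀ k → Frequently λ m → G._≈_ k (proj₁ (y m) k) (proj₁ c k))
    cluster-thread y = (proj₁ ∘ cluster , proj₂ ∘ next) , proj₂ ∘ cluster
      where
      Cluster : ℕ → Set
      Cluster k = ∃[ v ] Frequently λ m → G._≈_ k (proj₁ (y m) k) v

      extend : ∀ k → ((v , _) : Cluster k) →
               Σ[ (w , _) ∈ Cluster (suc k) ] G._≈_ k (Func.to (bond k) w) v
      extend k (v , freq) =
        let w , freq′ = frequently-value em (obj (suc k)) (obj-finite (suc k))
                          (λ m → proj₁ (y m) (suc k)) freq
            -- A single index with both values suffices for compatibility, because `y m` is itself a
            -- thread.
            m , _ , yₖ≈v , yₖ₊₁≈w = freq′ 0
        in (w , frequently-map proj₂ freq′) ,
           V.trans k (Func.cong (bond k) (V.sym (suc k) yₖ₊₁≈w))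
             (V.trans k (proj₂ (y m) k) yₖ≈v)

      cluster : ∀ k → Cluster k
      cluster zero = map₂ (frequently-map proj₂)
        (frequently-value em (obj 0) (obj-finite 0) {P = U} (λ m → proj₁ (y m) 0)
          (λ M → M , ≤-refl , _))
      cluster (suc k) = proj₁ (extend k (cluster k))

      next : ∀ k → Σ[ (w , _) ∈ Cluster (suc k) ] G._≈_ k (Func.to (bond k) w) (proj₁ (cluster k))
      next k = extend k (cluster k)

    -- If every ball around `x` fails, there are edges from `z` to `y`, with `z` tending to `x`,
    -- whose ends differ at coordinate `n`. A cluster thread of the ends `y` is adjacent to `x` but
    -- differs from it at `n`.
    neighboursAgreeAt-open : ∀ n → Lim.IsOpen (NeighboursAgreeAt n)
    neighboursAgreeAt-open n x agree =
      decidable-stable em λ ¬open → disagree (counterexample ¬open)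
      where
      Counterexample : ℕ → Set
      Counterexample m = ∃₂ λ z y →
        AgreeUpTo L m x z × Lim.Adj z y × ¬ (G._≈_ n (proj₁ y n) (proj₁ z n))

      counterexample : ¬ (∃[ m ] (∀ z → AgreeUpTo L m x z → NeighboursAgreeAt n z)) →
                       ∀ m → Counterexample m
      counterexample ¬open m = decidable-stable em λ ¬c →
        ¬open (m , λ z x≈z y z~y → decidable-stable em λ y≉z → ¬c (z , y , x≈z , z~y , y≉z))

      disagree : ¬ (∀ m → Counterexample m)
      disagree c =
        let y , freq = cluster-thread (λ m → proj₁ (proj₂ (c m)))
            x~y : Lim.Adj x y
            x~y k =
              -- An index `m ≥ k` is needed so that `z` already agrees with `x` at coordinate `k`.
              let m , k≤m , yₘ≈y = freq k k
                  z , _ , x≈z , z~yₘ , _ = c m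
              in proj₁ (G.Adj-resp k) yₘ≈y
                   (proj₂ (G.Adj-resp k) (V.sym k (x≈z k k≤m)) (z~yₘ k))
            m , n≤m , yₘ≈y = freq n n
            z , _ , x≈z , _ , yₘ≉z = c m
        in yₘ≉z (V.trans n yₘ≈y (V.trans n (agree y x~y) (x≈z n n≤m)))

-- Adding an isolated vertex to a finite graph.

module _ (S : Graph) where
  private
    module S = Graph S
    module V = Setoid S.vertices

  -- The new vertex is `nothing`: `Pointwise` relates it only to itself, so the same construction
  -- serves for equality and adjacency.
  withIsolated : Graph
  withIsolated = record
    { vertices = Pointwise.setoid S.vertices
    ; Adj      = Pointwise S.Adj
    ; Adj-resp = (λ { (just p) (just a) → just (proj₁ S.Adj-resp p a) ; nothing nothing → nothing })
               , (λ { (just p) (just a) → just (proj₂ S.Adj-resp p a) ; nothing nothing → nothing })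
    ; Adj-refl = Pointwise.refl S.Adj-refl
    ; Adj-sym  = Pointwise.sym S.Adj-sym
    }

  withIsolated-finite : S.Finite → Graph.Finite withIsolated
  withIsolated-finite (n , Fin↔S) = suc n , record
    { to        = to
    ; from      = from
    ; to-cong   = λ { refl → Pointwise.refl V.refl }
    ; from-cong = λ { (just p) → cong Fin.suc (F.from-cong p) ; nothing → refl }
    ; inverse   = (λ { {just _} refl → just (F.strictlyInverseˡ _) ; {nothing} refl → nothing })
                , λ { {Fin.zero} nothing → refl ; {Fin.suc _} (just p) → cong Fin.suc (F.inverseʳ p) }
    }
    where
    module F = Inverse Fin↔S

    to : Fin (suc n) → Maybe S.Vertex
    to Fin.zero    = nothing
    to (Fin.suc i) = just (F.to i)

    from : Maybe S.Vertex → Fin (suc n)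
    from nothing  = Fin.zero
    from (just v) = Fin.suc (F.from v)

  collapse : S.Vertex → VertexMap withIsolated S
  collapse v = record
    { to   = fromMaybe v
    ; cong = λ { (just p) → p ; nothing → V.refl }
    }

  -- The copy of `S` under `just` already witnesses strictness and surjectivity; the only edge at
  -- `nothing` is a loop, sent to the loop at `v`.
  collapse-quotient : ∀ v → IsQuotientMap withIsolated S (collapse v)
  collapse-quotient v = record
    { homomorphism = λ { (just a) → a ; nothing → S.Adj-refl }
    ; strict       = λ p q _ _ p~q → just p , just q , just p~q , V.refl , V.refl
    ; surjective   = λ p → just p , V.refl
    }

-- Isolated vertices of `ℙ`.

module _ (ℙ : TopologicalGraph) (universal : IsUniversalHomogeneous ℙ) where
  open IsUniversalHomogeneous universal
  open IsProfinite profinite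
  private
    L = sequence
    open InverseSequence L
    module ℙ = TopologicalGraph ℙ
    module VP = Setoid ℙ.vertices
    module Lim = TopologicalGraph (limit L)
    module G n = Graph (obj n)
    module V n = Setoid (G.vertices n)
    module I = TopologicalGraphIso iso
    open Inverse I.inverse using (to; from; to-cong; from-cong; strictlyInverseˡ; strictlyInverseʳ)

    toObj : ∀ n → VertexMap ℙ.graph (obj n)
    toObj n = record { to = λ p → proj₁ (to p) n ; cong = λ p≈q → to-cong p≈q n }

    toObj-quotient : ∀ n → IsContinuousQuotientMap ℙ (discrete (obj n)) (toObj n)
    toObj-quotient n = record
      { continuous = λ A A-open → I.to-continuous _ (projection-continuous L n A A-open)
      ; quotient   = record
        { homomorphism = λ p~q → I.to-homomorphism p~q n
        ; strict       = λ a b _ _ a~b →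
            let x , y , x~y , x↦a , y↦b = lift-edge L n a~b
            in from x , from y , I.from-homomorphism x~y ,
               V.trans n (strictlyInverseˡ x n) x↦a , V.trans n (strictlyInverseˡ y n) y↦b
        ; surjective   = λ a →
            let x , x↦a = projection-surjective L n a
            in from x , V.trans n (strictlyInverseˡ x n) x↦a
        }
      }

    -- With `g` the lift of coordinate `n` through `collapse`, the preimage of `nothing` is
    -- nonempty, open and closed under adjacency, and it lies over `v`. Any sufficiently deep ball
    -- inside it is a refinement.
    refine : ∀ n x → ∃₂ (Refinement L n x)
    refine n x = m , to p , s≤s (m≤m⊔n n _) ,
                 agreeUpTo L x (to p) n x≈to-p , λ z y p≈z z~y →
                   agreeUpTo L x y n (confined z y (proj₂ fibre-nbhd z λ i i≤k →
                     p≈z i (≤-trans i≤k (≤-trans (m≤n⊔m n _) (n≤1+n _)))) z~y)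
      where
      S = obj n
      v = proj₁ x n
      T = withIsolated S
      module T = Graph T

      lifting = extension S T (obj-finite n) (withIsolated-finite S (obj-finite n)) v nothing
                  (toObj n) (toObj-quotient n) (collapse S v) (collapse-quotient S v)
      g = Func.to (proj₁ lifting)
      g-lifts = proj₂ (proj₂ lifting)
      open IsContinuousQuotientMap (proj₁ (proj₂ lifting))
      open IsQuotientMap quotient

      p : ℙ.Vertex
      p = proj₁ (surjective nothing)

      over-nothing : ∀ r → g r T.≈ nothing → G._≈_ n v (proj₁ (to r) n)
      over-nothing r gr≈ = V.trans n
        (V.sym n (Func.cong (collapse S v) gr≈)) (g-lifts r)

      x≈to-p : G._≈_ n v (proj₁ (to p) n)
      x≈to-p = over-nothing p (proj₂ (surjective nothing))

      Fibre : Pred (Thread L) 0ℓ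
      Fibre z = g (from z) T.≈ nothing

      fibre-open : Lim.IsOpen Fibre
      fibre-open = I.from-continuous _
        (continuous (T._≈ nothing) (λ a≈b a≈ → Setoid.trans T.vertices (Setoid.sym T.vertices a≈b) a≈))

      fibre-nbhd = fibre-open (to p) (Pointwise.trans (V.trans n)
        (Func.cong (proj₁ lifting) (strictlyInverseʳ p)) (proj₂ (surjective nothing)))

      -- The successor gives `n < m`; the second argument of the maximum keeps the ball inside
      -- `Fibre`.
      m = suc (n ⊔ proj₁ fibre-nbhd)

      confined : ∀ z y → Fibre z → Lim.Adj z y → G._≈_ n v (proj₁ y n)
      confined z y gz≈ z~y = V.trans n (over-nothing (from y)
        (isolated gz≈ (homomorphism (I.from-homomorphism z~y)))) (strictlyInverseˡ y n)
        where
        isolated : ∀ {a b} → a T.≈ nothing → T.Adj a b → b T.≈ nothing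
        isolated nothing nothing = nothing

  isolated-to⇒isolated : ∀ p → Lim.Isolated (to p) → ℙ.Isolated p
  isolated-to⇒isolated p isolated q p~q = VP.trans (VP.sym (strictlyInverseʳ q))
    (VP.trans (from-cong (isolated (to q) (I.to-homomorphism p~q))) (strictlyInverseʳ p))

  -- Refinement is started from a ball around `to p` contained in the image of `A`, so the isolated
  -- thread it produces stays in that ball.
  isolated-dense : ℙ.Dense ℙ.Isolated
  isolated-dense A A-open (p , p∈A) =
    let n , nbhd = I.from-continuous A A-open (to p)
                     (ℙ.open-resp-≈ A-open (VP.sym (strictlyInverseʳ p)) p∈A)
        z , x≈z , z-isolated = refinable⇒isolated L refine n (to p)
        to-from = strictlyInverseˡ z
    in from z , nbhd z x≈z , isolated-to⇒isolated (from z) λ y z~y k → V.trans k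
         (z-isolated y (λ i → proj₂ (G.Adj-resp i) (to-from i) (z~y i)) k) (V.sym k (to-from k))

  -- Equality in the limit is coordinatewise, so isolation splits into one condition per coordinate,
  -- each open by compactness and pulled back along `to`.
  isolated-Gδ : ExcludedMiddle 0ℓ → ℙ.Gδ ℙ.Isolated
  isolated-Gδ em =
    (λ n → NeighboursAgreeAt L n ∘ to) ,
    (λ n → I.to-continuous _ (neighboursAgreeAt-open L em n)) ,
    (λ {p} isolated n y p~y → V.trans n (V.sym n (strictlyInverseˡ y n))
      (to-cong (isolated (from y) (proj₂ ℙ.Adj-resp (strictlyInverseʳ p) (I.from-homomorphism p~y))) n)) ,
    λ {p} agree → isolated-to⇒isolated p λ y p~y n → agree n y p~y

theorem3p4 : ExcludedMiddle 0ℓ →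
    (ℙ : TopologicalGraph) → IsUniversalHomogeneous ℙ →
    TopologicalGraph.Dense ℙ (TopologicalGraph.Isolated ℙ) ×
    TopologicalGraph.Gδ ℙ (TopologicalGraph.Isolated ℙ)
theorem3p4 em ℙ universal = isolated-dense ℙ universal , isolated-Gδ ℙ universal em
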